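{- Let $p$ be an odd prime and let $h\in\mathbb{Z}$ with $2h-1\equiv 0\pmod{p}$. If $a\in\mathbb{Z}^{+}$ and $p^a>3$, then \[ \sum_{k=0}^{p^a-1}\binom{hp^a-1}{k}\binom{2k}{k}\Big(-\frac{h}{2}\Big)^k\equiv 0\pmod{p^{a+1}}. \] Also, for any $n\in\mathbb{Z}^{+}$ we have \[ \nu_p\bigg(\sum_{k=0}^{n-1}\binom{hn-1}{k}\binom{2k}{k}\Big(-\frac{h}{2}\Big)^k\bigg)\geq \nu_p(n). \]
   Context: For a nonzero integer $n$, $\nu_p(n)$ denotes the $p$-adic valuation of $n$ (the largest integer $e$ with $p^e\mid n$), with $\nu_p(0)=+\infty$, and $\nu_p(m/n)=\nu_p(m)-\nu_p(n)$ for rationals. Since $p$ is odd, $2$ is invertible modulo $p$, so the sums are rational numbers that are $p$-adic integers, and congruences are understood in the ring $\mathbb{Z}_p$ of $p$-adic integers. -}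

module Defs where

open import Data.Nat as ℕ using (ℕ; zero; suc)
open import Data.Nat.Combinatorics using (_C_)
open import Data.Integer as ℤ using (ℤ; +_)
open import Data.Integer.Divisibility as ℤDiv using ()
open import Data.Rational as ℚ using (ℚ; _/_; ↥_; 0ℚ; 1ℚ; _+_; _*_)

powQ : ℚ → ℕ → ℚ
powQ q zero    = 1ℚ
powQ q (suc k) = powQ q k * q

binomQ : ℤ → ℕ → ℚ
binomQ x zero    = 1ℚ
binomQ x (suc k) = binomQ x k * ((x ℤ.- + k) / suc k)

sumQ : ℕ → (ℕ → ℚ) → ℚ
sumQ zero    f = 0ℚ
sumQ (suc n) f = sumQ n f + f n

S : ℤ → ℕ → ℚ
S h n = sumQ n (λ k → binomQ (h ℤ.* + n ℤ.- + 1) k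
                      * ((+ ((2 ℕ.* k) C k)) / 1)
                      * powQ ((ℤ.- h) / 2) k)

-- "q ≡ 0 (mod m)" for a rational q (in lowest terms) whose denominator is
-- coprime to the relevant prime: m divides the numerator of q.
DivQ : ℕ → ℚ → Set
DivQ m q = (+ m) ℤDiv.∣ (↥ q)

{-# OPTIONS --safe #-}
module Submission where

-- Let w = 1 − 2h, x = hn − 1, N = (1 − h)n, m = n − 1 and T(i, l) = (2i)! (2l)! / (i! l! (i + l)!).
-- The relation T(i + 1, l) + T(i, l + 1) = 4 T(i, l) turns the sum into
--   4ᵐ S = ∑_j (x choose j) wʲ U_j,   U_j = ∑_{i + l = m} (N choose i − j) T(i, l),
-- and absorption for the binomials together with n T(i + 1, l) = 2 (2i + 1) T(i, l) gives
-- 2 (2j + 1) U_j = n V_j with V_j an integer. As p ∣ w and 2j + 1 < pʲ⁺¹, the factor wʲ makes up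
-- for the power of p in 2j + 1, which is the second claim. For n = pᵃ > 3 an additional factor p
-- is needed: it comes from wʲ when j ≥ 2, since then 2j + 1 < pʲ, and from p ∣ V_j when j ≤ 1.

open import Defs
open import Data.Nat as ℕ using (ℕ; zero; suc; z≤n; s≤s)
import Data.Nat.Divisibility as ℕ
import Data.Nat.Properties as ℕ
open import Data.Nat.Combinatorics using (_C_; nCk+nC[k+1]≡[n+1]C[k+1])
open import Data.Nat.Primality using (Prime; prime[2]; euclidsLemma; prime⇒nonZero; prime⇒nonTrivial)
open import Data.Integer as ℤ using (ℤ; +_)
import Data.Integer.Properties as ℤ
open import Data.Integer.Divisibility as ℤDiv using ()
open import Data.Integer.Divisibility.Signed using (∣ᵤ⇒∣)
open import Data.Product using (_×_; _,_; ∃-syntax)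
open import Data.Sum using (_⊎_; inj₁; inj₂; [_,_]′)
open import Relation.Binary.PropositionalEquality
open import Relation.Nullary using (¬_; yes; no; contradiction)

module Integral where

  open import Data.Integer
    using (-[1+_]; _+_; _*_; _-_; -_; _^_; 0ℤ; 1ℤ; -1ℤ; ∣_∣)
  open import Data.Integer.Divisibility.Signed
  open import Data.Integer.Tactic.RingSolver using (solve-∀)
  open import Data.Rational as ℚ using (ℚ; _/_; toℚᵘ)
  import Data.Rational.Properties as ℚ
  open import Data.Rational.Unnormalised as ℚᵘ using (mkℚᵘ; *≡*)
  import Data.Rational.Unnormalised.Properties as ℚᵘ
  open import Algebra.Bundles using (CommutativeMonoid)
  open import Algebra.Properties.CommutativeSemigroup
    (CommutativeMonoid.commutativeSemigroup ℚ.*-1-commutativeMonoid) using (interchange; x∙yz≈y∙xz)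

  -- Cancellation and linear combinations of integer equations.

  ℤ-cancel : ∀ k {a b} → (1ℤ + + k) * a ≡ (1ℤ + + k) * b → a ≡ b
  ℤ-cancel k {a} {b} = ℤ.*-cancelˡ-≡ (+ suc k) a b

  +-vanish : ∀ d u v → u + d * (v - v) ≡ u
  +-vanish = solve-∀

  -- linear₁ … linear₄ derive an equation from its expression as a linear combination of
  -- known ones, which leaves a polynomial identity for the ring solver.
  linear₁ : ∀ c {a b l r} → l ≡ r → a - b ≡ c * (l - r) → a ≡ b
  linear₁ c {a} {b} {l} refl e = ℤ.i-j≡0⇒i≡j a b (trans e (trans (cong (c *_) (ℤ.+-inverseʳ l)) (ℤ.*-zeroʳ c)))

  linear₂ : ∀ c d {a b l r l′ r′} → l ≡ r → l′ ≡ r′ → a - b ≡ c * (l - r) + d * (l′ - r′) → a ≡ b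
  linear₂ c d {l = l} {r} {l′} e refl eq = linear₁ c e (trans eq (+-vanish d (c * (l - r)) l′))

  linear₃ : ∀ c d f {a b l r l′ r′ l″ r″} → l ≡ r → l′ ≡ r′ → l″ ≡ r″ →
    a - b ≡ c * (l - r) + d * (l′ - r′) + f * (l″ - r″) → a ≡ b
  linear₃ c d f {l = l} {r} {l′} {r′} {l″} e e′ refl eq =
    linear₂ c d e e′ (trans eq (+-vanish f (c * (l - r) + d * (l′ - r′)) l″))

  linear₄ : ∀ c d f g {a b l r l′ r′ l″ r″ l‴ r‴} → l ≡ r → l′ ≡ r′ → l″ ≡ r″ → l‴ ≡ r‴ →
    a - b ≡ c * (l - r) + d * (l′ - r′) + f * (l″ - r″) + g * (l‴ - r‴) → a ≡ b
  linear₄ c d f g {l = l} {r} {l′} {r′} {l″} {r″} {l‴} e e′ e″ refl eq =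
    linear₃ c d f e e′ e″ (trans eq (+-vanish g (c * (l - r) + d * (l′ - r′) + f * (l″ - r″)) l‴))

  -- Binomial coefficients with an arbitrary integer on top.

  ℤ-ind : ∀ {ℓ} (P : ℤ → Set ℓ) → P 0ℤ →
    (∀ x → P x → P (1ℤ + x)) → (∀ x → P (1ℤ + x) → P x) → ∀ x → P x
  ℤ-ind P z up down (+ zero) = z
  ℤ-ind P z up down (+ suc n) = up (+ n) (ℤ-ind P z up down (+ n))
  ℤ-ind P z up down -[1+ zero ] = down -[1+ 0 ] z
  ℤ-ind P z up down -[1+ suc n ] = down -[1+ suc n ] (ℤ-ind P z up down -[1+ n ])

  -- Pascal's rule run downwards extends the binomial coefficients to negative tops.
  bin : ℤ → ℕ → ℤ
  bin x            zero    = 1ℤ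
  bin (+ zero)     (suc k) = 0ℤ
  bin (+ suc n)    (suc k) = bin (+ n) (suc k) + bin (+ n) k
  bin -[1+ zero ]  (suc k) = - bin -[1+ 0 ] k
  bin -[1+ suc n ] (suc k) = bin -[1+ n ] (suc k) - bin -[1+ suc n ] k

  bin-pascal : ∀ x k → bin (1ℤ + x) (suc k) ≡ bin x (suc k) + bin x k
  bin-pascal (+ n) k = refl
  bin-pascal -[1+ zero ] k = sym (ℤ.+-inverseˡ (bin -[1+ 0 ] k))
  bin-pascal -[1+ suc n ] k = lem (bin -[1+ n ] (suc k)) (bin -[1+ suc n ] k)
    where
    lem : ∀ a b → a ≡ (a - b) + b
    lem = solve-∀

  -- By Pascal's rule and the identity for `k`, the difference of the two sides for `suc k` is the
  -- same at `x` and at `1ℤ + x` (this is `aux`), and at `0ℤ` both sides vanish.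
  bin-step : ∀ x k → (1ℤ + + k) * bin x (suc k) ≡ (x - + k) * bin x k
  bin-step x zero = ℤ-ind (λ x → (1ℤ + 0ℤ) * bin x 1 ≡ (x - 0ℤ) * 1ℤ) refl
    (λ x ih → linear₂ 1ℤ 1ℤ (bin-pascal x 0) ih (up x (bin x 1) (bin (1ℤ + x) 1)))
    (λ x ih → linear₂ -1ℤ 1ℤ (bin-pascal x 0) ih (down x (bin x 1) (bin (1ℤ + x) 1))) x
    where
    up : ∀ x b d → (1ℤ + 0ℤ) * d - (1ℤ + x - 0ℤ) * 1ℤ ≡ 1ℤ * (d - (b + 1ℤ)) + 1ℤ * ((1ℤ + 0ℤ) * b - (x - 0ℤ) * 1ℤ)
    up = solve-∀
    down : ∀ x b d → (1ℤ + 0ℤ) * b - (x - 0ℤ) * 1ℤ ≡ -1ℤ * (d - (b + 1ℤ)) + 1ℤ * ((1ℤ + 0ℤ) * d - (1ℤ + x - 0ℤ) * 1ℤ)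
    down = solve-∀
  bin-step x (suc k) = ℤ-ind P
    (trans (ℤ.*-zeroʳ (1ℤ + + suc k)) (sym (ℤ.*-zeroʳ (0ℤ - + suc k))))
    (λ x ih → ℤ.i-j≡0⇒i≡j _ _ (trans (aux x) (ℤ.i≡j⇒i-j≡0 ih)))
    (λ x ih → ℤ.i-j≡0⇒i≡j _ _ (trans (sym (aux x)) (ℤ.i≡j⇒i-j≡0 ih)))
    x
    where
    P : ℤ → Set
    P x = (1ℤ + (1ℤ + + k)) * bin x (2 ℕ.+ k) ≡ (x - (1ℤ + + k)) * bin x (suc k)
    comb : ∀ K x a b c d e →
      (1ℤ + (1ℤ + K)) * e - (1ℤ + x - (1ℤ + K)) * d - ((1ℤ + (1ℤ + K)) * c - (x - (1ℤ + K)) * b)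
      ≡ (1ℤ + (1ℤ + K)) * (e - (c + b)) + (K - x) * (d - (b + a)) + 1ℤ * ((1ℤ + K) * b - (x - K) * a)
    comb = solve-∀
    aux : ∀ x → (1ℤ + (1ℤ + + k)) * bin (1ℤ + x) (2 ℕ.+ k) - (1ℤ + x - (1ℤ + + k)) * bin (1ℤ + x) (suc k)
              ≡ (1ℤ + (1ℤ + + k)) * bin x (2 ℕ.+ k) - (x - (1ℤ + + k)) * bin x (suc k)
    aux x = linear₃ (1ℤ + (1ℤ + + k)) (+ k - x) 1ℤ (bin-pascal x (suc k)) (bin-pascal x k) (bin-step x k)
      (comb (+ k) x (bin x k) (bin x (suc k)) (bin x (2 ℕ.+ k)) (bin (1ℤ + x) (suc k)) (bin (1ℤ + x) (2 ℕ.+ k)))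

  bin-absorb : ∀ x k → (1ℤ + + k) * bin x (suc k) ≡ x * bin (x - 1ℤ) k
  bin-absorb x k = linear₂ (1ℤ + + k) 1ℤ pas (bin-step y k)
    (lem (+ k) x (bin y k) (bin y (suc k)) (bin x (suc k)))
    where
    y = x - 1ℤ
    1+y : ∀ x → 1ℤ + (x - 1ℤ) ≡ x
    1+y = solve-∀
    pas : bin x (suc k) ≡ bin y (suc k) + bin y k
    pas = trans (cong (λ z → bin z (suc k)) (sym (1+y x))) (bin-pascal y k)
    lem : ∀ K x a b d → (1ℤ + K) * d - x * a
        ≡ (1ℤ + K) * (d - (b + a)) + 1ℤ * ((1ℤ + K) * b - (x - 1ℤ - K) * a)
    lem = solve-∀

  bin-row : ∀ x k → (x - + k) * bin x k ≡ x * bin (x - 1ℤ) k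
  bin-row x k = trans (sym (bin-step x k)) (bin-absorb x k)

  -- Upper negation. Absorption lowers top and index together, which preserves the shape
  -- `+ k - 1ℤ - x`, so induction on `k` applies.
  bin-neg : ∀ k x → bin (+ k - 1ℤ - x) k ≡ -1ℤ ^ k * bin x k
  bin-neg zero x = refl
  bin-neg (suc k) x = ℤ-cancel k
    (linear₃ 1ℤ (1ℤ + + k - 1ℤ - x) (-1ℤ ^ k)
      (trans (bin-absorb (1ℤ + + k - 1ℤ - x) k)
             (cong (λ z → (1ℤ + + k - 1ℤ - x) * bin z k) (pred (+ k) x)))
      (bin-neg k x) (bin-step x k)
      (lem (+ k) x (-1ℤ ^ k) (bin (1ℤ + + k - 1ℤ - x) (suc k)) (bin (+ k - 1ℤ - x) k) (bin x k) (bin x (suc k))))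
    where
    pred : ∀ K x → 1ℤ + K - 1ℤ - x - 1ℤ ≡ K - 1ℤ - x
    pred = solve-∀
    lem : ∀ K x S d a b c → (1ℤ + K) * d - (1ℤ + K) * (-1ℤ * S * c)
        ≡ 1ℤ * ((1ℤ + K) * d - (1ℤ + K - 1ℤ - x) * a) + (1ℤ + K - 1ℤ - x) * (a - S * b)
          + S * ((1ℤ + K) * c - (x - K) * b)
    lem = solve-∀

  -- Trinomial revision: both sides are x (x - 1) ... (x - k + 1) / (j! r!). The induction on `r`
  -- compares the ratios of consecutive terms.
  bin-trinomial : ∀ x j r {k} → j ℕ.+ r ≡ k → bin x j * bin (x - + j) r ≡ bin x k * bin (+ k) j
  bin-trinomial x j zero {k} e with trans (sym (ℕ.+-identityʳ j)) e
  ... | refl = cong (bin x j *_) (sym (bin-diag j))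
    where
    bin-diag : ∀ j → bin (+ j) j ≡ 1ℤ
    bin-diag zero = refl
    bin-diag (suc j) = ℤ-cancel j (linear₂ 1ℤ (1ℤ + + j) (bin-absorb (+ suc j) j) (bin-diag j)
      (lem (1ℤ + + j) (bin (+ suc j) (suc j)) (bin (+ j) j)))
      where
      lem : ∀ K d a → K * d - K * 1ℤ ≡ 1ℤ * (K * d - K * a) + K * (a - 1ℤ)
      lem = solve-∀
  bin-trinomial x j (suc r) {k} e with trans (sym (ℕ.+-suc j r)) e
  ... | refl = ℤ-cancel r (linear₄ (bin x j) (x - + j - + r) (- bin (+ (j ℕ.+ r)) j) (- bin x (suc (j ℕ.+ r)))
      (bin-step (x - + j) r) (bin-trinomial x j r refl) (bin-step x (j ℕ.+ r)) (bin-row (+ suc (j ℕ.+ r)) j)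
      (lem x (+ j) (+ r) (bin x j) (bin (x - + j) r) (bin (x - + j) (suc r)) (bin x (j ℕ.+ r)) (bin x (suc (j ℕ.+ r)))
           (bin (+ (j ℕ.+ r)) j) (bin (+ suc (j ℕ.+ r)) j)))
    where
    lem : ∀ x J R A B B′ C C′ E E′ → (1ℤ + R) * (A * B′) - (1ℤ + R) * (C′ * E′)
        ≡ A * ((1ℤ + R) * B′ - (x - J - R) * B) + (x - J - R) * (A * B - C * E)
          + (- E) * ((1ℤ + (J + R)) * C′ - (x - (J + R)) * C)
          + (- C′) * ((1ℤ + (J + R) - J) * E′ - (1ℤ + (J + R)) * E)
    lem = solve-∀

  -- Sums over antidiagonals.

  -- The sum of g i l over i + l = m.
  ∑ : (ℕ → ℕ → ℤ) → ℕ → ℤ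
  ∑ g zero    = g 0 0
  ∑ g (suc m) = g 0 (suc m) + ∑ (λ i → g (suc i)) m

  ∑-cong : ∀ {g h} m → (∀ i l → i ℕ.+ l ≡ m → g i l ≡ h i l) → ∑ g m ≡ ∑ h m
  ∑-cong zero    e = e 0 0 refl
  ∑-cong (suc m) e = cong₂ _+_ (e 0 (suc m) refl) (∑-cong m (λ i l p → e (suc i) l (cong suc p)))

  ∑-zero : ∀ {g} m → (∀ i l → i ℕ.+ l ≡ m → g i l ≡ 0ℤ) → ∑ g m ≡ 0ℤ
  ∑-zero zero    e = e 0 0 refl
  ∑-zero (suc m) e = cong₂ _+_ (e 0 (suc m) refl) (∑-zero m (λ i l p → e (suc i) l (cong suc p)))

  ∑-+ : ∀ g h m → ∑ (λ i l → g i l + h i l) m ≡ ∑ g m + ∑ h m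
  ∑-+ g h zero    = refl
  ∑-+ g h (suc m) = trans (cong (_+_ (g 0 (suc m) + h 0 (suc m))) (∑-+ (λ i → g (suc i)) (λ i → h (suc i)) m))
    (lem (g 0 (suc m)) (h 0 (suc m)) (∑ (λ i → g (suc i)) m) (∑ (λ i → h (suc i)) m))
    where
    lem : ∀ a b c d → a + b + (c + d) ≡ a + c + (b + d)
    lem = solve-∀

  ∑-* : ∀ c g m → ∑ (λ i l → c * g i l) m ≡ c * ∑ g m
  ∑-* c g zero    = refl
  ∑-* c g (suc m) = trans (cong (_+_ (c * g 0 (suc m))) (∑-* c (λ i → g (suc i)) m))
    (sym (ℤ.*-distribˡ-+ c (g 0 (suc m)) (∑ (λ i → g (suc i)) m)))

  ∑-last : ∀ g m → ∑ g (suc m) ≡ ∑ (λ i l → g i (suc l)) m + g (suc m) 0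
  ∑-last g zero    = refl
  ∑-last g (suc m) = trans (cong (_+_ (g 0 (2 ℕ.+ m))) (∑-last (λ i → g (suc i)) m))
    (sym (ℤ.+-assoc (g 0 (2 ℕ.+ m)) (∑ (λ i l → g (suc i) (suc l)) m) (g (2 ℕ.+ m) 0)))

  ∑-∣ : ∀ {d g} m → (∀ i l → i ℕ.+ l ≡ m → d ∣ g i l) → d ∣ ∑ g m
  ∑-∣ zero    e = e 0 0 refl
  ∑-∣ (suc m) e = ∣m∣n⇒∣m+n (e 0 (suc m) refl) (∑-∣ m (λ i l p → e (suc i) l (cong suc p)))

  ∑-single : ∀ {d g} m i₀ l₀ → i₀ ℕ.+ l₀ ≡ m → (∀ i l → i ℕ.+ l ≡ m → i ≢ i₀ → d ∣ g i l) →
    d ∣ ∑ g m - g i₀ l₀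
  ∑-single {d} {g} zero zero zero refl _ = subst (d ∣_) (sym (ℤ.+-inverseʳ (g 0 0))) (divides 0ℤ refl)
  ∑-single {d} {g} (suc m) zero .(suc m) refl e =
    subst (d ∣_) (lem (g 0 (suc m)) (∑ (λ i → g (suc i)) m))
      (∑-∣ m (λ i l p → e (suc i) l (cong suc p) (λ ())))
    where
    lem : ∀ a b → b ≡ a + b - a
    lem = solve-∀
  ∑-single {d} {g} (suc m) (suc i₀) l₀ p e =
    subst (d ∣_) (sym (ℤ.+-assoc (g 0 (suc m)) (∑ (λ i → g (suc i)) m) (- g (suc i₀) l₀)))
      (∣m∣n⇒∣m+n (e 0 (suc m) refl (λ ()))
        (∑-single m i₀ l₀ (ℕ.suc-injective p) (λ i l q i≢ → e (suc i) l (cong suc q) (λ eq → i≢ (ℕ.suc-injective eq)))))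

  -- Shifted binomial coefficients and the sums `U`.

  -- The coefficient of tⁱ in tʲ (1 + t)ᴺ.
  β : ℤ → ℕ → ℕ → ℤ
  β N i       zero    = bin N i
  β N zero    (suc j) = 0ℤ
  β N (suc i) (suc j) = β N i j

  β-pascal : ∀ N i j → β (1ℤ + N) (suc i) j ≡ β N (suc i) j + β N i j
  β-pascal N i       zero          = bin-pascal N i
  β-pascal N zero    (suc zero)    = refl
  β-pascal N zero    (suc (suc j)) = refl
  β-pascal N (suc i) (suc j)       = β-pascal N i j

  β-zero : ∀ M N j → β M 0 j ≡ β N 0 j
  β-zero M N zero    = refl
  β-zero M N (suc j) = refl

  β-shift : ∀ N j r → β N (j ℕ.+ r) j ≡ bin N r
  β-shift N zero    r = refl
  β-shift N (suc j) r = β-shift N j r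

  β-< : ∀ N {i j} → i ℕ.< j → β N i j ≡ 0ℤ
  β-< N {zero}  {suc j} _         = refl
  β-< N {suc i} {suc j} (s≤s i<j) = β-< N i<j

  -- Absorption for N choose i - j. Raising `j` encodes the lower index i - j - 1 without truncated
  -- subtraction, since `β` is 0 when that index is negative.
  β-absorb : ∀ N i j → (+ i - + j) * β N i j ≡ N * β (N - 1ℤ) i (suc j)
  β-absorb N zero    zero    = sym (ℤ.*-zeroʳ N)
  β-absorb N (suc i) zero    = trans (cong (_* bin N (suc i)) (ℤ.+-identityʳ (+ suc i))) (bin-absorb N i)
  β-absorb N zero    (suc j) = trans (ℤ.*-zeroʳ (0ℤ - + suc j)) (sym (ℤ.*-zeroʳ N))
  β-absorb N (suc i) (suc j) = trans (cong (_* β N i j) (lem (+ i) (+ j))) (β-absorb N i j)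
    where
    lem : ∀ I J → 1ℤ + I - (1ℤ + J) ≡ I - J
    lem = solve-∀

  U : (ℕ → ℕ → ℤ) → ℤ → ℕ → ℕ → ℤ
  U s N m j = ∑ (λ i l → β N i j * s i l) m

  -- Pascal's rule splits the sum in two. After an index shift in one of them the terms pair up as
  -- s(i + 1, l) + s(i, l + 1) = τ s(i, l), and only the boundary term i = m + 1 is left over.
  U-step : ∀ τ s → (∀ i l → s (suc i) l + s i (suc l) ≡ τ * s i l) → ∀ N m j →
    U s (1ℤ + N) (suc m) j ≡ τ * U s N m j + β N (suc m) j * s (suc m) 0
  U-step τ s s-rec N m j = begin
    β (1ℤ + N) 0 j * s 0 (suc m) + ∑ (λ i l → β (1ℤ + N) (suc i) j * s (suc i) l) m
      ≡⟨ cong₂ (λ u v → u * s 0 (suc m) + v) (β-zero (1ℤ + N) N j)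
          (trans (∑-cong m (λ i l _ → trans (cong (_* s (suc i) l) (β-pascal N i j))
                                            (ℤ.*-distribʳ-+ (s (suc i) l) (β N (suc i) j) (β N i j))))
                 (∑-+ (λ i l → β N (suc i) j * s (suc i) l) (λ i l → β N i j * s (suc i) l) m)) ⟩
    h 0 (suc m) + (∑ (λ i → h (suc i)) m + ∑ k m)
      ≡⟨ ℤ.+-assoc (h 0 (suc m)) (∑ (λ i → h (suc i)) m) (∑ k m) ⟨
    U s N (suc m) j + ∑ k m
      ≡⟨ cong (_+ ∑ k m) (∑-last h m) ⟩
    ∑ (λ i l → h i (suc l)) m + h (suc m) 0 + ∑ k m
      ≡⟨ swap (∑ (λ i l → h i (suc l)) m) (h (suc m) 0) (∑ k m) ⟩
    ∑ k m + ∑ (λ i l → h i (suc l)) m + h (suc m) 0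
      ≡⟨ cong (_+ h (suc m) 0) (∑-+ k (λ i l → h i (suc l)) m) ⟨
    ∑ (λ i l → k i l + h i (suc l)) m + h (suc m) 0
      ≡⟨ cong (_+ h (suc m) 0) (trans (∑-cong m (λ i l _ → pt i l)) (∑-* τ h m)) ⟩
    τ * U s N m j + β N (suc m) j * s (suc m) 0 ∎
    where
    open ≡-Reasoning
    h k : ℕ → ℕ → ℤ
    h i l = β N i j * s i l
    k i l = β N i j * s (suc i) l
    swap : ∀ a b c → a + b + c ≡ c + a + b
    swap = solve-∀
    ring : ∀ b s₁ s₂ t s → b * s₁ + b * s₂ - t * (b * s) ≡ b * (s₁ + s₂ - t * s)
    ring = solve-∀
    pt : ∀ i l → k i l + h i (suc l) ≡ τ * h i l
    pt i l = linear₁ (β N i j) (s-rec i l) (ring (β N i j) (s (suc i) l) (s i (suc l)) τ (s i l))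

  -- The binomial theorem and the expansion of `L` in powers of w.

  bin-vanish : ∀ n → bin (+ n) (suc n) ≡ 0ℤ
  bin-vanish n = ℤ-cancel n (trans (bin-step (+ n) n)
    (trans (cong (_* bin (+ n) n) (ℤ.+-inverseʳ (+ n))) (sym (ℤ.*-zeroʳ (1ℤ + + n)))))

  -- The case j = 0, s(i, l) = aⁱ bˡ, τ = a + b of `U-step`; the boundary term contains m choose m +
  -- 1 and vanishes.
  binomial-theorem : ∀ a b m → ∑ (λ i l → bin (+ m) i * (a ^ i * b ^ l)) m ≡ (a + b) ^ m
  binomial-theorem a b zero    = refl
  binomial-theorem a b (suc m) = linear₂ (a + b) (a * a ^ m * 1ℤ)
    (binomial-theorem a b m) (bin-vanish m)
    (trans (cong (_- (a + b) * (a + b) ^ m) (U-step (a + b) (λ i l → a ^ i * b ^ l) (λ i l → s-rec a b (a ^ i) (b ^ l)) (+ m) m 0))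
      (lem (a + b) (U (λ i l → a ^ i * b ^ l) (+ m) m 0) ((a + b) ^ m) (a * a ^ m * 1ℤ) (bin (+ m) (suc m))))
    where
    s-rec : ∀ a b A B → a * A * B + A * (b * B) ≡ (a + b) * (A * B)
    s-rec = solve-∀
    lem : ∀ t u v s z → t * u + z * s - t * v ≡ t * (u - v) + s * (z - 0ℤ)
    lem = solve-∀

  -- The left side is the coefficient of tᵏ in (1 + w t)ˣ (1 + t)ᵏ⁻¹⁻ˣ.
  twisted-vandermonde : ∀ x w k →
    ∑ (λ j r → bin x j * w ^ j * bin (+ k - 1ℤ - x) r) k ≡ (w - 1ℤ) ^ k * bin x k
  twisted-vandermonde x w k = begin
    ∑ (λ j r → bin x j * w ^ j * bin (+ k - 1ℤ - x) r) k
      ≡⟨ ∑-cong k pt ⟩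
    ∑ (λ j r → bin x k * (bin (+ k) j * (w ^ j * -1ℤ ^ r))) k
      ≡⟨ ∑-* (bin x k) (λ j r → bin (+ k) j * (w ^ j * -1ℤ ^ r)) k ⟩
    bin x k * ∑ (λ j r → bin (+ k) j * (w ^ j * -1ℤ ^ r)) k
      ≡⟨ cong (bin x k *_) (binomial-theorem w -1ℤ k) ⟩
    bin x k * (w - 1ℤ) ^ k
      ≡⟨ ℤ.*-comm (bin x k) ((w - 1ℤ) ^ k) ⟩
    (w - 1ℤ) ^ k * bin x k ∎
    where
    open ≡-Reasoning
    arg : ∀ J R x → J + R - 1ℤ - x ≡ R - 1ℤ - (x - J)
    arg = solve-∀
    lem : ∀ a b c W S B y → a * W * y - b * (c * (W * S))
        ≡ (a * W) * (y - S * B) + (W * S) * (a * B - b * c)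
    lem = solve-∀
    pt : ∀ j r → j ℕ.+ r ≡ k →
      bin x j * w ^ j * bin (+ k - 1ℤ - x) r ≡ bin x k * (bin (+ k) j * (w ^ j * -1ℤ ^ r))
    -- With k = j + r, upper negation turns the last factor into (-1)ʳ (x - j choose r), and
    -- trinomial revision extracts x choose k. What remains is a term of the binomial expansion of
    -- (w - 1)ᵏ.
    pt j r refl = linear₂ (bin x j * w ^ j) (w ^ j * -1ℤ ^ r)
      (trans (cong (λ z → bin z r) (arg (+ j) (+ r) x)) (bin-neg r (x - + j)))
      (bin-trinomial x j r refl)
      (lem (bin x j) (bin x k) (bin (+ k) j) (w ^ j) (-1ℤ ^ r) (bin (x - + j) r) (bin (+ k - 1ℤ - x) r))

  -- ∑_{k ≤ m} τᵐ⁻ᵏ (w − 1)ᵏ (x choose k) s(k, 0)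
  L : ℤ → (ℕ → ℕ → ℤ) → ℤ → ℤ → ℕ → ℤ
  L τ s w x zero    = s 0 0
  L τ s w x (suc m) = τ * L τ s w x m + (w - 1ℤ) ^ suc m * bin x (suc m) * s (suc m) 0

  -- Both sides satisfy the recurrence defining L; only the coefficient of s(m + 1, 0) has to be
  -- compared, and that is twisted-vandermonde.
  L-expansion : ∀ τ s → (∀ i l → s (suc i) l + s i (suc l) ≡ τ * s i l) → ∀ w x m →
    L τ s w x m ≡ ∑ (λ j _ → bin x j * w ^ j * U s (+ m - x) m j) m
  L-expansion τ s s-rec w x zero = lem (s 0 0)
    where
    lem : ∀ a → a ≡ 1ℤ * 1ℤ * (1ℤ * a)
    lem = solve-∀
  L-expansion τ s s-rec w x (suc m) = sym (begin
    ∑ (λ j _ → bin x j * w ^ j * U s (+ suc m - x) (suc m) j) (suc m)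
      ≡⟨ ∑-cong (suc m) pt ⟩
    ∑ (λ j r → τ * g j r + s₀ * h j r) (suc m)
      ≡⟨ trans (∑-+ (λ j r → τ * g j r) (λ j r → s₀ * h j r) (suc m))
               (cong₂ _+_ (∑-* τ g (suc m)) (∑-* s₀ h (suc m))) ⟩
    τ * ∑ g (suc m) + s₀ * ∑ h (suc m)
      ≡⟨ cong₂ (λ u v → τ * u + s₀ * v) ∑g (twisted-vandermonde x w (suc m)) ⟩
    τ * L τ s w x m + s₀ * ((w - 1ℤ) ^ suc m * bin x (suc m))
      ≡⟨ cong (_+_ (τ * L τ s w x m)) (ℤ.*-comm s₀ ((w - 1ℤ) ^ suc m * bin x (suc m))) ⟩
    L τ s w x (suc m) ∎)
    where
    open ≡-Reasoning
    s₀ = s (suc m) 0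
    N = + m - x
    g h : ℕ → ℕ → ℤ
    g j _ = bin x j * w ^ j * U s N m j
    h j r = bin x j * w ^ j * bin N r
    1+N : ∀ M x → 1ℤ + M - x ≡ 1ℤ + (M - x)
    1+N = solve-∀
    lem : ∀ c u t v b s₀ → c * u - (t * (c * v) + s₀ * (c * b)) ≡ c * (u - (t * v + b * s₀))
    lem = solve-∀
    pt : ∀ j r → j ℕ.+ r ≡ suc m →
      bin x j * w ^ j * U s (+ suc m - x) (suc m) j ≡ τ * g j r + s₀ * h j r
    pt j r e = linear₁ (bin x j * w ^ j)
      (trans (cong (λ z → U s z (suc m) j) (1+N (+ m) x))
      (trans (U-step τ s s-rec N m j)
             (cong (λ z → τ * U s N m j + z * s₀) (trans (cong (λ z → β N z j) (sym e)) (β-shift N j r)))))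
      (lem (bin x j * w ^ j) (U s (+ suc m - x) (suc m) j) τ (U s N m j) (bin N r) s₀)
    ∑g : ∑ g (suc m) ≡ L τ s w x m
    ∑g = begin
      ∑ g (suc m)                      ≡⟨ ∑-last g m ⟩
      -- The term j = m + 1 vanishes: its inner sum runs over i ≤ m < j, where `β` is 0.
      ∑ g m + g (suc m) 0              ≡⟨ cong (_+_ (∑ g m)) (trans (cong (_*_ (bin x (suc m) * w ^ suc m))
        (∑-zero m (λ i l e → cong (_* s i l) (β-< N (s≤s (subst (i ℕ.≤_) e (ℕ.m≤m+n i l)))))))
        (ℤ.*-zeroʳ (bin x (suc m) * w ^ suc m))) ⟩
      ∑ g m + 0ℤ                       ≡⟨ ℤ.+-identityʳ (∑ g m) ⟩
      ∑ g m                            ≡⟨ L-expansion τ s s-rec w x m ⟨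
      L τ s w x m ∎

  -- Central binomial coefficients and super Catalan numbers.

  centralBin : ℕ → ℤ
  centralBin k = bin (+ 2 * + k) k

  centralBin-step : ∀ k → (1ℤ + + k) * centralBin (suc k) ≡ + 2 * (1ℤ + + 2 * + k) * centralBin k
  centralBin-step k = ℤ-cancel k (linear₂ (1ℤ + + k) (+ 2 * (1ℤ + + k)) abs row
    (lem (+ k) c′ (bin (1ℤ + X) k) (bin X k)))
    where
    X = + 2 * + k
    c′ = centralBin (suc k)
    top : ∀ K → + 2 * (1ℤ + K) ≡ 1ℤ + (1ℤ + + 2 * K)
    top = solve-∀
    pr : ∀ X → 1ℤ + X - 1ℤ ≡ X
    pr = solve-∀
    abs : (1ℤ + + k) * c′ ≡ (1ℤ + (1ℤ + X)) * bin (1ℤ + X) k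
    abs = trans (cong (λ z → (1ℤ + + k) * bin z (suc k)) (top (+ k)))
      (trans (bin-absorb (1ℤ + (1ℤ + X)) k) (cong (λ z → (1ℤ + (1ℤ + X)) * bin z k) (pr (1ℤ + X))))
    row : (1ℤ + X - + k) * bin (1ℤ + X) k ≡ (1ℤ + X) * bin X k
    row = trans (bin-row (1ℤ + X) k) (cong (λ z → (1ℤ + X) * bin z k) (pr X))
    lem : ∀ K c′ d c → (1ℤ + K) * ((1ℤ + K) * c′) - (1ℤ + K) * (+ 2 * (1ℤ + + 2 * K) * c)
      ≡ (1ℤ + K) * ((1ℤ + K) * c′ - (1ℤ + (1ℤ + + 2 * K)) * d)
        + (+ 2 * (1ℤ + K)) * ((1ℤ + + 2 * K - K) * d - (1ℤ + + 2 * K) * c)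
    lem = solve-∀

  centralBin-C : ∀ k → centralBin k ≡ + ((2 ℕ.* k) C k)
  centralBin-C k = trans (cong (λ z → bin z k) (sym (ℤ.pos-* 2 k))) (bin-C (2 ℕ.* k) k)
    where
    bin-C : ∀ n k → bin (+ n) k ≡ + (n C k)
    bin-C n       zero    = sym (cong +_ refl)
    bin-C zero    (suc k) = refl
    bin-C (suc n) (suc k) = trans (cong₂ _+_ (bin-C n (suc k)) (bin-C n k))
      (cong +_ (trans (ℕ.+-comm (n C suc k) (n C k)) (nCk+nC[k+1]≡[n+1]C[k+1] n k)))

  -- (2i)! (2l)! / (i! l! (i + l)!)
  superCatalan : ℕ → ℕ → ℤ
  superCatalan i zero    = centralBin i
  superCatalan i (suc l) = + 4 * superCatalan i l - superCatalan (suc i) l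

  superCatalan-rec : ∀ i l → superCatalan (suc i) l + superCatalan i (suc l) ≡ + 4 * superCatalan i l
  superCatalan-rec i l = lem (superCatalan (suc i) l) (+ 4 * superCatalan i l)
    where
    lem : ∀ a b → a + (b - a) ≡ b
    lem = solve-∀

  -- The instances for i and i + 1 give the next `l`, because `superCatalan i (suc l)` is defined
  -- from these two entries. On the antidiagonal i + l = m the left factor is n = m + 1, one source
  -- of the factor n in `U-factor`.
  superCatalan-step : ∀ i l →
    (1ℤ + (+ i + + l)) * superCatalan (suc i) l ≡ + 2 * (1ℤ + + 2 * + i) * superCatalan i l
  superCatalan-step i zero = trans (cong (λ z → (1ℤ + z) * centralBin (suc i)) (ℤ.+-identityʳ (+ i))) (centralBin-step i)
  superCatalan-step i (suc l) = linear₂ (+ 4) -1ℤ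
    (superCatalan-step i l) (superCatalan-step (suc i) l)
    (lem (+ i) (+ l) (superCatalan i l) (superCatalan (suc i) l) (superCatalan (2 ℕ.+ i) l))
    where
    lem : ∀ I R a b c → (1ℤ + (I + (1ℤ + R))) * (+ 4 * b - c) - + 2 * (1ℤ + + 2 * I) * (+ 4 * a - b)
      ≡ + 4 * ((1ℤ + (I + R)) * b - + 2 * (1ℤ + + 2 * I) * a)
        + -1ℤ * ((1ℤ + (1ℤ + I + R)) * c - + 2 * (1ℤ + + 2 * (1ℤ + I)) * b)
    lem = solve-∀

  -- The factor n of 2 (2j + 1) U_j.

  V : ℤ → ℕ → ℕ → ℤ
  V c m j = ∑ (λ i l → β (c * + suc m) i j * superCatalan (suc i) l) m
          - + 4 * c * ∑ (λ i l → β (c * + suc m - 1ℤ) i (suc j) * superCatalan i l) m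

  -- Termwise, 2 (2j + 1) = 2 (2i + 1) - 4 (i - j). The first part yields n by `superCatalan-step`,
  -- as i + l + 1 = n; the second yields N = c n by `β-absorb`.
  U-factor : ∀ c m j →
    + 2 * (1ℤ + + 2 * + j) * U superCatalan (c * + suc m) m j ≡ + suc m * V c m j
  U-factor c m j = trans (sym (∑-* (+ 2 * (1ℤ + + 2 * + j)) (λ i l → β N i j * superCatalan i l) m))
    (trans (∑-cong m pt)
    (trans (∑-+ (λ i l → n * A i l) (λ i l → - (n * (+ 4 * c)) * B i l) m)
    (trans (cong₂ _+_ (∑-* n A m) (∑-* (- (n * (+ 4 * c))) B m))
           (fin n (+ 4 * c) (∑ A m) (∑ B m)))))
    where
    n = + suc m
    N = c * n
    A B : ℕ → ℕ → ℤ
    A i l = β N i j * superCatalan (suc i) l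
    B i l = β (N - 1ℤ) i (suc j) * superCatalan i l
    fin : ∀ n k a b → n * a + - (n * k) * b ≡ n * (a - k * b)
    fin = solve-∀
    lem : ∀ I J n c b b′ s s′ → + 2 * (1ℤ + + 2 * J) * (b * s) - (n * (b * s′) + - (n * (+ 4 * c)) * (b′ * s))
      ≡ (- b) * (n * s′ - + 2 * (1ℤ + + 2 * I) * s) + (- + 4 * s) * ((I - J) * b - c * n * b′)
    lem = solve-∀
    pt : ∀ i l → i ℕ.+ l ≡ m →
      + 2 * (1ℤ + + 2 * + j) * (β N i j * superCatalan i l) ≡ n * A i l + - (n * (+ 4 * c)) * B i l
    pt i l refl = linear₂ (- β N i j) (- + 4 * superCatalan i l) (superCatalan-step i l) (β-absorb N i j)
      (lem (+ i) (+ j) n c (β N i j) (β (N - 1ℤ) i (suc j)) (superCatalan i l) (superCatalan (suc i) l))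

  -- Cancelling and trading prime powers.

  module _ {p : ℕ} (pr : Prime p) where

    private instance
      p≢0 : ℕ.NonZero p
      p≢0 = prime⇒nonZero pr

    prime-power-cancel : ∀ e x y → ¬ p ℕ.∣ x → p ℕ.^ e ℕ.∣ x ℕ.* y → p ℕ.^ e ℕ.∣ y
    prime-power-cancel zero    x y p∤x _ = ℕ.1∣ y
    prime-power-cancel (suc e) x y p∤x h with euclidsLemma x y pr (ℕ.∣-trans (ℕ.m∣m*n (p ℕ.^ e)) h)
    ... | inj₁ p∣x = contradiction p∣x p∤x
    ... | inj₂ (ℕ.divides q refl) = subst (p ℕ.^ suc e ℕ.∣_) (ℕ.*-comm p q)
      (ℕ.*-monoʳ-∣ p (prime-power-cancel e x q p∤x
        (ℕ.*-cancelˡ-∣ p (subst (p ℕ.^ suc e ℕ.∣_) (trans (sym (ℕ.*-assoc x q p)) (ℕ.*-comm (x ℕ.* q) p)) h))))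

    -- The valuation of d is at most j when 0 < d < pʲ⁺¹.
    prime-power-trade : ∀ j e d y → .{{ℕ.NonZero d}} → d ℕ.< p ℕ.^ suc j →
      p ℕ.^ e ℕ.∣ d ℕ.* y → p ℕ.^ e ℕ.∣ p ℕ.^ j ℕ.* y
    prime-power-trade j zero d y _ _ = ℕ.1∣ _
    prime-power-trade j (suc e) d y d< h with p ℕ.∣? d
    ... | no p∤d = ℕ.∣n⇒∣m*n (p ℕ.^ j) (prime-power-cancel (suc e) d y p∤d h)
    prime-power-trade zero (suc e) d y d< h | yes p∣d =
      contradiction (subst (d ℕ.<_) (ℕ.*-identityʳ p) d<) (ℕ.≤⇒≯ (ℕ.∣⇒≤ p∣d))
    prime-power-trade (suc j) (suc e) d y d< h | yes (ℕ.divides q refl) =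
      subst (p ℕ.^ suc e ℕ.∣_) (sym (ℕ.*-assoc p (p ℕ.^ j) y)) (ℕ.*-monoʳ-∣ p
        (prime-power-trade j e q y {{ℕ.m*n≢0⇒m≢0 q}}
          (ℕ.*-cancelʳ-< p q (p ℕ.^ suc j) (subst (q ℕ.* p ℕ.<_) (ℕ.*-comm p (p ℕ.^ suc j)) d<))
          (ℕ.*-cancelˡ-∣ p (subst (p ℕ.^ suc e ℕ.∣_) (trans (cong (ℕ._* y) (ℕ.*-comm q p)) (ℕ.*-assoc p q y)) h))))

    -- If p did not divide y, then y could be cancelled and the whole power would divide x.
    prime-power-∣-* : ∀ {a x y} → + (p ℕ.^ a) ∣ x * y → ¬ + (p ℕ.^ a) ∣ x → + p ∣ y
    prime-power-∣-* {a} {x} {y} h p∤x with + p ∣? y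
    ... | yes p∣y = p∣y
    ... | no p∤y = contradiction
      (∣ᵤ⇒∣ (prime-power-cancel a ∣ y ∣ ∣ x ∣ (λ q → p∤y (∣ᵤ⇒∣ q))
        (subst (p ℕ.^ a ℕ.∣_) (trans (ℤ.abs-* x y) (ℕ.*-comm ∣ x ∣ ∣ y ∣)) (∣⇒∣ᵤ h)))) p∤x

    -- `prime-power-trade` carried over to integers, with pʲ replaced by its multiple wʲ. It is
    -- applied to d = 2j + 1 or, after one factor w is split off, to d = 2j + 3.
    trade : ∀ {j e d y w} → .{{ℕ.NonZero d}} → d ℕ.< p ℕ.^ suc j → + p ∣ w →
      + (p ℕ.^ e) ∣ + d * y → + (p ℕ.^ e) ∣ w ^ j * y
    trade {j} {e} {d} {y} {w} d< p∣w h = ∣-trans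
      (∣ᵤ⇒∣ (subst (p ℕ.^ e ℕ.∣_) (sym (ℤ.abs-* (+ (p ℕ.^ j)) y))
        (prime-power-trade j e d ∣ y ∣ d< (subst (p ℕ.^ e ℕ.∣_) (ℤ.abs-* (+ d) y) (∣⇒∣ᵤ h)))))
      (*-monoˡ-∣ y (power j))
      where
      power : ∀ j → + (p ℕ.^ j) ∣ w ^ j
      power zero    = ∣-refl
      power (suc j) = subst (_∣ w * w ^ j) (sym (ℤ.pos-* p (p ℕ.^ j)))
        (∣-trans (*-monoˡ-∣ (+ (p ℕ.^ j)) p∣w) (*-monoʳ-∣ w (power j)))

  -- Congruences modulo p for n = pᵃ = 2μ + 1.

  -- On the diagonal the factor 1 + 2μ cancels from `superCatalan-step`, so T(μ + 1, μ) = 2 T(μ, μ),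
  -- and the recurrence leaves 4 - 2 = 2 for the other neighbour.
  superCatalan-middle : ∀ μ → superCatalan μ (suc μ) ≡ + 2 * superCatalan μ μ
  superCatalan-middle μ = trans (cong (λ z → + 4 * s - z) next) (lem s)
    where
    s = superCatalan μ μ
    next : superCatalan (suc μ) μ ≡ + 2 * s
    next = ℤ-cancel (μ ℕ.+ μ) (trans (superCatalan-step μ μ) (lem′ (+ μ) s))
      where
      lem′ : ∀ M s → + 2 * (1ℤ + + 2 * M) * s ≡ (1ℤ + (M + M)) * (+ 2 * s)
      lem′ = solve-∀
    lem : ∀ s → + 4 * s - + 2 * s ≡ + 2 * s
    lem = solve-∀

  module _ {p : ℕ} (pr : Prime p) (p∤2 : ¬ (p ℕ.∣ 2)) where

    halve : ∀ e {x} → + (p ℕ.^ e) ∣ + 2 * x → + (p ℕ.^ e) ∣ x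
    halve e {x} h = ∣ᵤ⇒∣ (prime-power-cancel pr e 2 ∣ x ∣ p∤2
      (subst (p ℕ.^ e ℕ.∣_) (ℤ.abs-* (+ 2) x) (∣⇒∣ᵤ h)))

    module _ {a μ : ℕ} (n≡ : suc (μ ℕ.+ μ) ≡ p ℕ.^ a) where

      private
        m n : ℕ
        m = μ ℕ.+ μ
        n = suc m

        n∣⇒ : ∀ {x} → + n ∣ x → + (p ℕ.^ a) ∣ x
        n∣⇒ {x} = subst (λ k → + k ∣ x) n≡

      -- By absorption n = pᵃ divides d + 1 times the coefficient, but not d + 1 itself, as 0 < d +
      -- 1 < n.
      bin-∣ : ∀ {N} → + n ∣ N → ∀ {d} → suc d ℕ.< n → + p ∣ bin N (suc d)
      bin-∣ {N} n∣N {d} d< = prime-power-∣-* pr {a} {+ suc d}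
        (n∣⇒ (subst (+ n ∣_) (sym (bin-absorb N d)) (∣m⇒∣m*n (bin (N - 1ℤ) d) n∣N)))
        (λ h → ℕ.>⇒∤ d< (subst (ℕ._∣ suc d) (sym n≡) (∣⇒∣ᵤ h)))

      -- By Pascal's rule consecutive entries of row N - 1 add up to an entry of row N, which is 0
      -- modulo p; hence the signs alternate.
      bin-pred-≡ : ∀ {N} → + n ∣ N → ∀ r → r ℕ.< n → + p ∣ bin (N - 1ℤ) r - -1ℤ ^ r
      bin-pred-≡ n∣N zero r< = divides 0ℤ refl
      bin-pred-≡ {N} n∣N (suc r) r< = subst (+ p ∣_)
        (trans (cong (_- (bin (N - 1ℤ) r - -1ℤ ^ r)) pas)
               (lem (bin (N - 1ℤ) r) (bin (N - 1ℤ) (suc r)) (-1ℤ ^ r)))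
        (∣m∣n⇒∣m-n (bin-∣ n∣N r<) (bin-pred-≡ n∣N r (ℕ.<⇒≤ r<)))
        where
        1+y : ∀ x → 1ℤ + (x - 1ℤ) ≡ x
        1+y = solve-∀
        pas : bin N (suc r) ≡ bin (N - 1ℤ) (suc r) + bin (N - 1ℤ) r
        pas = trans (cong (λ z → bin z (suc r)) (sym (1+y N))) (bin-pascal (N - 1ℤ) r)
        lem : ∀ b b′ S → b′ + b - (b - S) ≡ b′ - -1ℤ * S
        lem = solve-∀

      β-∣ : ∀ {N} → + n ∣ N → ∀ i j → i ℕ.< n → i ≢ j → + p ∣ β N i j
      β-∣ {N} n∣N zero    zero    i< i≢j = contradiction refl i≢j
      β-∣ {N} n∣N (suc i) zero    i< i≢j = bin-∣ n∣N i<
      β-∣ {N} n∣N zero    (suc j) i< i≢j = divides 0ℤ refl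
      β-∣ {N} n∣N (suc i) (suc j) i< i≢j = β-∣ n∣N i j (ℕ.<⇒≤ i<) (λ e → i≢j (cong suc e))

      -- Since i + l + 1 = n = pᵃ and p is odd, `superCatalan-step` shows that pᵃ divides (2i + 1)
      -- T(i, l). As 0 < 2i + 1 < 2n, it can divide 2i + 1 only if 2i + 1 = n, that is, i = μ.
      superCatalan-∣ : ∀ i l → i ℕ.+ l ≡ m → i ≢ μ → + p ∣ superCatalan i l
      superCatalan-∣ i l e i≢μ = prime-power-∣-* pr {a} {1ℤ + + 2 * + i}
        (halve a (subst (+ (p ℕ.^ a) ∣_) (trans (superCatalan-step i l) (ℤ.*-assoc (+ 2) (1ℤ + + 2 * + i) (superCatalan i l)))
          (∣m⇒∣m*n (superCatalan (suc i) l) (∣-reflexive (cong +_ (trans (sym n≡) (cong suc (sym e))))))))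
        (λ h → odd-multiple (subst (ℕ._∣ suc (2 ℕ.* i)) (sym n≡)
          (∣⇒∣ᵤ (subst (λ z → + (p ℕ.^ a) ∣ 1ℤ + z) (sym (ℤ.pos-* 2 i)) h))))
        where
        i≤m : i ℕ.≤ m
        i≤m = subst (i ℕ.≤_) e (ℕ.m≤m+n i l)
        odd-multiple : ¬ n ℕ.∣ suc (2 ℕ.* i)
        odd-multiple (ℕ.divides (suc zero) eq) = i≢μ (ℕ.*-cancelˡ-≡ i μ 2
          (trans (ℕ.suc-injective (trans eq (ℕ.*-identityˡ n))) (cong (μ ℕ.+_) (sym (ℕ.+-identityʳ μ)))))
        odd-multiple (ℕ.divides (suc (suc q)) eq) = ℕ.<-irrefl eq (begin-strict
          suc (2 ℕ.* i)       ≤⟨ s≤s (ℕ.*-monoʳ-≤ 2 i≤m) ⟩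
          suc (2 ℕ.* m)       <⟨ ℕ.n<1+n (suc (2 ℕ.* m)) ⟩
          2 ℕ.+ 2 ℕ.* m       ≡⟨ ℕ.*-suc 2 m ⟨
          2 ℕ.* n             ≤⟨ ℕ.*-monoˡ-≤ n {2} {2 ℕ.+ q} (s≤s (s≤s z≤n)) ⟩
          (2 ℕ.+ q) ℕ.* n     ∎)
          where open ℕ.≤-Reasoning

      -- Neighbours on the antidiagonal k + l = n add up to 4 times an entry on the previous one,
      -- which is 0 modulo p away from i = μ. So the value only changes sign along the r steps from
      -- the middle, where it is 2 T(μ, μ).
      superCatalan-≡ : ∀ r k l → k ℕ.+ r ≡ μ → k ℕ.+ l ≡ n →
        + p ∣ superCatalan k l - -1ℤ ^ r * (+ 2 * superCatalan μ μ)
      superCatalan-≡ zero k l kr kl with trans (sym (ℕ.+-identityʳ k)) kr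
      ... | refl with ℕ.+-cancelˡ-≡ μ l (suc μ) (trans kl (sym (ℕ.+-suc μ μ)))
      ... | refl = subst (+ p ∣_)
        (sym (trans (cong (_- 1ℤ * (+ 2 * superCatalan μ μ)) (superCatalan-middle μ)) (lem (+ 2 * superCatalan μ μ))))
        (divides 0ℤ refl)
        where
        lem : ∀ x → x - 1ℤ * x ≡ 0ℤ
        lem = solve-∀
      superCatalan-≡ (suc r) k zero kr kl =
        contradiction (subst (n ℕ.≤_) kr (subst (ℕ._≤ k ℕ.+ suc r) (trans (sym (ℕ.+-identityʳ k)) kl) (ℕ.m≤m+n k (suc r))))
          (ℕ.<⇒≱ (s≤s (ℕ.m≤m+n μ μ)))
      superCatalan-≡ (suc r) k (suc l) kr kl = subst (+ p ∣_)
        (lem (superCatalan k l) (superCatalan (suc k) l) (-1ℤ ^ r) (+ 2 * superCatalan μ μ))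
        (∣m∣n⇒∣m-n (∣n⇒∣m*n (+ 4) (superCatalan-∣ k l (ℕ.suc-injective kl′) k≢μ))
                   (superCatalan-≡ r (suc k) l (trans (sym (ℕ.+-suc k r)) kr) kl′))
        where
        kl′ : suc k ℕ.+ l ≡ n
        kl′ = trans (sym (ℕ.+-suc k l)) kl
        k≢μ : k ≢ μ
        k≢μ refl = ℕ.m≢1+m+n k (trans (sym kr) (ℕ.+-suc k r))
        lem : ∀ t u S x → + 4 * t - (u - S * x) ≡ + 4 * t - u - -1ℤ * S * x
        lem = solve-∀

      -- Modulo p only one term of either sum in V survives, namely i = j in the first (by β-∣) and
      -- i = μ in the second (by superCatalan-∣), and these two cancel.
      V-∣ : ∀ h → + p ∣ + 2 * h - 1ℤ → ∀ j → j ℕ.< μ → + p ∣ V (1ℤ - h) m j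
      V-∣ h p∣2h-1 j j<μ with ℕ.m≤n⇒∃[o]m+o≡n j<μ
      -- With s = T(μ, μ), the surviving terms are (-1)ʳ 2s and (-1)ʳ s, so V is congruent to (-1)ʳ
      -- (2s - 4 (1 - h) s) = (-1)ʳ 2s (2h - 1), which p divides.
      ... | r , e = subst (+ p ∣_)
        (lem h (∑ A m) (∑ B m) (superCatalan (suc j) l₀) (superCatalan μ μ) (bin (N - 1ℤ) r) (-1ℤ ^ r))
        (∣m∣n⇒∣m+n (∣m∣n⇒∣m+n (∣m∣n⇒∣m+n (∣m∣n⇒∣m+n ∑A
          (superCatalan-≡ r (suc j) l₀ e (cong suc jl₀)))
          (∣n⇒∣m*n (- (+ 4 * (1ℤ - h))) ∑B))
          (∣n⇒∣m*n (- (+ 4 * (1ℤ - h) * superCatalan μ μ)) (bin-pred-≡ n∣N r r<)))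
          (∣n⇒∣m*n (+ 2 * superCatalan μ μ * -1ℤ ^ r) p∣2h-1))
        where
        N = (1ℤ - h) * + n
        n∣N : + n ∣ N
        n∣N = ∣n⇒∣m*n (1ℤ - h) ∣-refl
        l₀ = suc (r ℕ.+ μ)
        jl₀ : j ℕ.+ l₀ ≡ m
        jl₀ = trans (ℕ.+-suc j (r ℕ.+ μ)) (trans (sym (ℕ.+-assoc (suc j) r μ)) (cong (ℕ._+ μ) e))
        r< : r ℕ.< n
        r< = s≤s (ℕ.≤-trans (subst (r ℕ.≤_) e (ℕ.m≤n+m r (suc j))) (ℕ.m≤m+n μ μ))
        A B : ℕ → ℕ → ℤ
        A i l = β N i j * superCatalan (suc i) l
        B i l = β (N - 1ℤ) i (suc j) * superCatalan i l
        ∑A : + p ∣ ∑ A m - superCatalan (suc j) l₀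
        ∑A = subst (λ z → + p ∣ ∑ A m - z)
          (trans (cong (_* superCatalan (suc j) l₀) (trans (cong (λ z → β N z j) (sym (ℕ.+-identityʳ j))) (β-shift N j 0)))
                 (ℤ.*-identityˡ (superCatalan (suc j) l₀)))
          (∑-single m j l₀ jl₀ (λ i l il i≢j → ∣m⇒∣m*n (superCatalan (suc i) l)
            (β-∣ n∣N i j (s≤s (subst (i ℕ.≤_) il (ℕ.m≤m+n i l))) i≢j)))
        ∑B : + p ∣ ∑ B m - bin (N - 1ℤ) r * superCatalan μ μ
        ∑B = subst (λ z → + p ∣ ∑ B m - z * superCatalan μ μ)
          (trans (cong (λ z → β (N - 1ℤ) z (suc j)) (sym e)) (β-shift (N - 1ℤ) (suc j) r))
          (∑-single m μ μ refl (λ i l il i≢μ → ∣n⇒∣m*n (β (N - 1ℤ) i (suc j)) (superCatalan-∣ i l il i≢μ)))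
        lem : ∀ h a b t s β S →
          a - t + (t - S * (+ 2 * s)) + - (+ 4 * (1ℤ - h)) * (b - β * s) + - (+ 4 * (1ℤ - h) * s) * (β - S)
            + + 2 * s * S * (+ 2 * h - 1ℤ)
          ≡ a - + 4 * (1ℤ - h) * b
        lem = solve-∀

  -- Comparison of 2j + 1 with powers of p.

  odd-bound-step : ∀ {p q} → 2 ℕ.≤ p → ∀ j → 1 ℕ.+ 2 ℕ.* j ℕ.< q → 1 ℕ.+ 2 ℕ.* suc j ℕ.< p ℕ.* q
  odd-bound-step {p} {q} p≥2 j j< = begin
    2 ℕ.+ 2 ℕ.* suc j              ≡⟨ ℕ.*-suc 2 (suc j) ⟨
    2 ℕ.* (2 ℕ.+ j)                ≤⟨ ℕ.*-monoʳ-≤ 2 (s≤s (s≤s (ℕ.m≤m+n j (j ℕ.+ 0)))) ⟩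
    2 ℕ.* (2 ℕ.+ 2 ℕ.* j)          ≤⟨ ℕ.*-mono-≤ p≥2 j< ⟩
    p ℕ.* q                        ∎
    where open ℕ.≤-Reasoning

  1+2j<p^[1+j] : ∀ {p} → 2 ℕ.≤ p → ∀ j → 1 ℕ.+ 2 ℕ.* j ℕ.< p ℕ.^ suc j
  1+2j<p^[1+j] {p} p≥2 zero    = subst (2 ℕ.≤_) (sym (ℕ.*-identityʳ p)) p≥2
  1+2j<p^[1+j] {p} p≥2 (suc j) = odd-bound-step p≥2 j (1+2j<p^[1+j] p≥2 j)

  -- The induction starts at exponent 2, where 5 < 9 ≤ p². At exponent 1 the bound 3 < p fails for p
  -- = 3, so j = 1 is left to `V-∣`.
  5+2j<p^[2+j] : ∀ {p} → 3 ℕ.≤ p → ∀ j → 1 ℕ.+ 2 ℕ.* (2 ℕ.+ j) ℕ.< p ℕ.^ (2 ℕ.+ j)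
  5+2j<p^[2+j] {p} p≥3 zero    = ℕ.≤-trans (ℕ.m≤m+n 6 3)
    (ℕ.*-mono-≤ p≥3 (subst (3 ℕ.≤_) (sym (ℕ.*-identityʳ p)) p≥3))
  5+2j<p^[2+j] {p} p≥3 (suc j) = odd-bound-step (ℕ.<⇒≤ p≥3) (2 ℕ.+ j) (5+2j<p^[2+j] p≥3 j)

  parity : ∀ n → (∃[ k ] n ≡ k ℕ.+ k) ⊎ (∃[ k ] n ≡ suc (k ℕ.+ k))
  parity zero = inj₁ (0 , refl)
  parity (suc n) with parity n
  ... | inj₁ (k , refl) = inj₂ (k , refl)
  ... | inj₂ (k , refl) = inj₁ (suc k , cong suc (sym (ℕ.+-suc k k)))

  odd-prime≥3 : ∀ {p} → Prime p → ¬ (2 ℕ.∣ p) → 3 ℕ.≤ p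
  odd-prime≥3 {p} pr 2∤p = ℕ.≤∧≢⇒< (ℕ.nonTrivial⇒n>1 p {{prime⇒nonTrivial pr}}) (λ { refl → 2∤p ℕ.∣-refl })

  -- Divisibility of the integer 4ᵐ S.

  module _ {p : ℕ} (pr : Prime p) (2∤p : ¬ (2 ℕ.∣ p)) where

    private
      p≥3 : 3 ℕ.≤ p
      p≥3 = odd-prime≥3 pr 2∤p

      p>1 : 1 ℕ.< p
      p>1 = ℕ.<⇒≤ p≥3

      p∤2 : ¬ p ℕ.∣ 2
      p∤2 = ℕ.>⇒∤ p≥3

    2∤p^ : ∀ a → ¬ 2 ℕ.∣ p ℕ.^ a
    2∤p^ zero h = contradiction (ℕ.∣⇒≤ h) λ { (s≤s ()) }
    2∤p^ (suc a) h = [ 2∤p , 2∤p^ a ]′ (euclidsLemma p (p ℕ.^ a) prime[2] h)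

    -- By `L-expansion` it suffices to treat each wʲ U_j; for x = h n - 1 the top m - x becomes (1 -
    -- h) n, a multiple of n.
    L-∣ : ∀ h m d → (∀ j → d ∣ (1ℤ - + 2 * h) ^ j * U superCatalan ((1ℤ - h) * + suc m) m j) →
      d ∣ L (+ 4) superCatalan (1ℤ - + 2 * h) (h * + suc m - 1ℤ) m
    L-∣ h m d div = subst (d ∣_) (sym (L-expansion (+ 4) superCatalan superCatalan-rec w x m))
      (∑-∣ m (λ j _ _ → subst (λ N → d ∣ bin x j * w ^ j * U superCatalan N m j) (sym (arg h (+ m)))
        (subst (d ∣_) (sym (ℤ.*-assoc (bin x j) (w ^ j) (U superCatalan ((1ℤ - h) * + suc m) m j)))
          (∣n⇒∣m*n (bin x j) (div j)))))
      where
      w = 1ℤ - + 2 * h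
      x = h * + suc m - 1ℤ
      arg : ∀ h M → M - (h * (1ℤ + M) - 1ℤ) ≡ (1ℤ - h) * (1ℤ + M)
      arg = solve-∀

    module _ (h : ℤ) (p∣2h-1 : + p ∣ + 2 * h - 1ℤ) where

      private
        w : ℤ
        w = 1ℤ - + 2 * h
        p∣w : + p ∣ w
        p∣w = subst (+ p ∣_) (lem h) (∣m⇒∣-m p∣2h-1)
          where
          lem : ∀ h → - (+ 2 * h - 1ℤ) ≡ 1ℤ - + 2 * h
          lem = solve-∀

      module _ (m : ℕ) where
        private
          u : ℕ → ℤ
          u = U superCatalan ((1ℤ - h) * + suc m) m

        odd-* : ∀ e j → + (p ℕ.^ e) ∣ + suc m * V (1ℤ - h) m j → + (p ℕ.^ e) ∣ + suc (2 ℕ.* j) * u j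
        odd-* e j d = halve pr p∤2 e (subst (+ (p ℕ.^ e) ∣_)
          (trans (sym (U-factor (1ℤ - h) m j)) (trans (ℤ.*-assoc (+ 2) (1ℤ + + 2 * + j) (u j))
            (cong (λ z → + 2 * ((1ℤ + z) * u j)) (sym (ℤ.pos-* 2 j))))) d)

        L-∣-general : ∀ e → p ℕ.^ e ℕ.∣ suc m → + (p ℕ.^ e) ∣ L (+ 4) superCatalan w (h * + suc m - 1ℤ) m
        L-∣-general e d = L-∣ h m (+ (p ℕ.^ e)) (λ j → trade pr {j} {e} {suc (2 ℕ.* j)} (1+2j<p^[1+j] p>1 j) p∣w
          (odd-* e j (∣m⇒∣m*n {m = + suc m} (V (1ℤ - h) m j) (∣ᵤ⇒∣ d))))

        L-∣-power : ∀ a → suc m ≡ p ℕ.^ a → 3 ℕ.< suc m →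
          + (p ℕ.^ suc a) ∣ L (+ 4) superCatalan w (h * + suc m - 1ℤ) m
        L-∣-power a n≡ n>3 with parity m
        ... | inj₂ (k , refl) = contradiction (subst (2 ℕ.∣_) n≡ (ℕ.divides (suc k) (lem k))) (2∤p^ a)
          where
          lem : ∀ k → suc (suc (k ℕ.+ k)) ≡ suc k ℕ.* 2
          lem k = cong (2 ℕ.+_) (trans (cong (k ℕ.+_) (sym (ℕ.+-identityʳ k))) (ℕ.*-comm 2 k))
        ... | inj₁ (μ , refl) = L-∣ h m (+ (p ℕ.^ suc a)) term
          where
          half : ∀ k → 3 ℕ.< suc (k ℕ.+ k) → 1 ℕ.< k
          half zero          (s≤s ())
          half (suc zero)    (s≤s (s≤s (s≤s ())))
          half (suc (suc k)) _ = s≤s (s≤s z≤n)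
          μ>1 : 1 ℕ.< μ
          μ>1 = half μ n>3
          small : ∀ j → j ℕ.< μ → + (p ℕ.^ suc a) ∣ w ^ j * u j
          -- Here p divides V_j, so n V_j is divisible by pᵃ⁺¹.
          small j j<μ = trade pr {j} {suc a} {suc (2 ℕ.* j)} (1+2j<p^[1+j] p>1 j) p∣w
            (odd-* (suc a) j (subst (_∣ + suc m * V (1ℤ - h) m j)
              (trans (sym (ℤ.pos-* (suc m) p)) (cong +_ (trans (cong (ℕ._* p) n≡) (ℕ.*-comm (p ℕ.^ a) p))))
              (*-monoʳ-∣ (+ suc m) (V-∣ pr p∤2 {a} {μ} n≡ h p∣2h-1 j j<μ))))
          term : ∀ j → + (p ℕ.^ suc a) ∣ w ^ j * u j
          term zero = small 0 (ℕ.<⇒≤ μ>1)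
          -- Here n > 3 enters: for μ = 1 the range of `V-∣` would not contain j = 1.
          term (suc zero) = small 1 μ>1
          -- One factor w supplies the additional p; the other j + 1 factors make up for 2j + 5 <
          -- pʲ⁺².
          term (suc (suc j)) = subst (+ (p ℕ.^ suc a) ∣_) (sym (ℤ.*-assoc w (w ^ suc j) (u (2 ℕ.+ j))))
            (subst (_∣ w * (w ^ suc j * u (2 ℕ.+ j))) (sym (ℤ.pos-* p (p ℕ.^ a)))
              (∣-trans (*-monoˡ-∣ (+ (p ℕ.^ a)) p∣w) (*-monoʳ-∣ w
                (trade pr {suc j} {a} {suc (2 ℕ.* (2 ℕ.+ j))} (5+2j<p^[2+j] p≥3 j) p∣w
                  (odd-* a (2 ℕ.+ j) (∣m⇒∣m*n {m = + suc m} (V (1ℤ - h) m (2 ℕ.+ j)) (∣-reflexive (cong +_ (sym n≡)))))))))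

  -- Passage from the rational sum to integers.

  ι : ℤ → ℚ
  ι z = z / 1

  ι-+ : ∀ a b → ι (a + b) ≡ ι a ℚ.+ ι b
  ι-+ a b = ℚ.toℚᵘ-injective (ℚᵘ.≃-trans (ℚ.toℚᵘ-fromℚᵘ (mkℚᵘ (a + b) 0)) (ℚᵘ.≃-sym
    (ℚᵘ.≃-trans (ℚ.toℚᵘ-homo-+ (ι a) (ι b))
    (ℚᵘ.≃-trans (ℚᵘ.+-cong (ℚ.toℚᵘ-fromℚᵘ (mkℚᵘ a 0)) (ℚ.toℚᵘ-fromℚᵘ (mkℚᵘ b 0)))
    (*≡* (lem a b))))))
    where
    lem : ∀ a b → (a * 1ℤ + b * 1ℤ) * 1ℤ ≡ (a + b) * 1ℤ
    lem = solve-∀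

  -- Only the product has to be integral, which allows for the fractions (x - k) / (k + 1) and -h /
  -- 2.
  ι-* : ∀ a b c d → a * b ≡ c * + suc d → ι a ℚ.* (b / suc d) ≡ ι c
  ι-* a b c d e = ℚ.toℚᵘ-injective (ℚᵘ.≃-trans (ℚ.toℚᵘ-homo-* (ι a) (b / suc d))
    (ℚᵘ.≃-trans (ℚᵘ.*-cong (ℚ.toℚᵘ-fromℚᵘ (mkℚᵘ a 0)) (ℚ.toℚᵘ-fromℚᵘ (mkℚᵘ b d)))
    (ℚᵘ.≃-trans (*≡* {mkℚᵘ a 0 ℚᵘ.* mkℚᵘ b d} {mkℚᵘ c 0} lem) (ℚᵘ.≃-sym (ℚ.toℚᵘ-fromℚᵘ (mkℚᵘ c 0))))))
    where
    lem : a * b * 1ℤ ≡ c * + suc (d ℕ.+ 0)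
    lem = trans (ℤ.*-identityʳ (a * b)) (trans e (cong (λ z → c * + suc z) (sym (ℕ.+-identityʳ d))))

  ι-*-ι : ∀ a b → ι (a * b) ≡ ι a ℚ.* ι b
  ι-*-ι a b = sym (ι-* a b (a * b) 0 (sym (ℤ.*-identityʳ (a * b))))

  binomQ-bin : ∀ x k → binomQ x k ≡ ι (bin x k)
  binomQ-bin x zero    = refl
  binomQ-bin x (suc k) = trans (cong (ℚ._* ((x - + k) / suc k)) (binomQ-bin x k))
    (ι-* (bin x k) (x - + k) (bin x (suc k)) k (trans (ℤ.*-comm (bin x k) (x - + k)) (trans (sym (bin-step x k)) (ℤ.*-comm (+ suc k) (bin x (suc k))))))

  -- Each factor contributes 4 (-h / 2) = -2h = w - 1, written unsimplified to match `L`.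
  4^-powQ : ∀ h k → ι ((+ 4) ^ k) ℚ.* powQ ((- h) / 2) k ≡ ι ((1ℤ - + 2 * h - 1ℤ) ^ k)
  4^-powQ h zero    = refl
  4^-powQ h (suc k) = begin
    ι (+ 4 * (+ 4) ^ k) ℚ.* (powQ q k ℚ.* q)
      ≡⟨ cong (ℚ._* (powQ q k ℚ.* q)) (trans (cong ι (ℤ.*-comm (+ 4) ((+ 4) ^ k))) (ι-*-ι ((+ 4) ^ k) (+ 4))) ⟩
    ι ((+ 4) ^ k) ℚ.* ι (+ 4) ℚ.* (powQ q k ℚ.* q)
      ≡⟨ interchange (ι ((+ 4) ^ k)) (ι (+ 4)) (powQ q k) q ⟩
    ι ((+ 4) ^ k) ℚ.* powQ q k ℚ.* (ι (+ 4) ℚ.* q)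
      ≡⟨ cong₂ ℚ._*_ (4^-powQ h k) (ι-* (+ 4) (- h) v 1 (lem h)) ⟩
    ι (v ^ k) ℚ.* ι v
      ≡⟨ ι-*-ι (v ^ k) v ⟨
    ι (v ^ k * v)
      ≡⟨ cong ι (ℤ.*-comm (v ^ k) v) ⟩
    ι (v * v ^ k) ∎
    where
    open ≡-Reasoning
    q = (- h) / 2
    v = 1ℤ - + 2 * h - 1ℤ
    lem : ∀ h → + 4 * - h ≡ (1ℤ - + 2 * h - 1ℤ) * + 2
    lem = solve-∀

  -- From m to m + 1 the earlier terms gain a factor 4, as in the recursion of `L`, while the new
  -- term absorbs its power of 4 through `4^-powQ`.
  4^-sumQ : ∀ h x m →
    ι ((+ 4) ^ m) ℚ.* sumQ (suc m) (λ k → binomQ x k ℚ.* (+ ((2 ℕ.* k) C k) / 1) ℚ.* powQ ((- h) / 2) k)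
    ≡ ι (L (+ 4) superCatalan (1ℤ - + 2 * h) x m)
  4^-sumQ h x zero    = refl
  4^-sumQ h x (suc m) = begin
    ι ((+ 4) ^ k) ℚ.* (sumQ k f ℚ.+ f k)
      ≡⟨ ℚ.*-distribˡ-+ (ι ((+ 4) ^ k)) (sumQ k f) (f k) ⟩
    ι ((+ 4) ^ k) ℚ.* sumQ k f ℚ.+ ι ((+ 4) ^ k) ℚ.* f k
      ≡⟨ cong₂ ℚ._+_ old new ⟩
    ι (+ 4 * Lm) ℚ.+ ι (v ^ k * bin x k * superCatalan k 0)
      ≡⟨ ι-+ (+ 4 * Lm) (v ^ k * bin x k * superCatalan k 0) ⟨
    ι (L (+ 4) superCatalan (1ℤ - + 2 * h) x k) ∎
    where
    open ≡-Reasoning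
    k = suc m
    v = 1ℤ - + 2 * h - 1ℤ
    q = (- h) / 2
    Lm = L (+ 4) superCatalan (1ℤ - + 2 * h) x m
    f : ℕ → ℚ
    f k = binomQ x k ℚ.* (+ ((2 ℕ.* k) C k) / 1) ℚ.* powQ q k
    old : ι ((+ 4) ^ k) ℚ.* sumQ k f ≡ ι (+ 4 * Lm)
    old = begin
      ι (+ 4 * (+ 4) ^ m) ℚ.* sumQ k f            ≡⟨ cong (ℚ._* sumQ k f) (ι-*-ι (+ 4) ((+ 4) ^ m)) ⟩
      ι (+ 4) ℚ.* ι ((+ 4) ^ m) ℚ.* sumQ k f      ≡⟨ ℚ.*-assoc (ι (+ 4)) (ι ((+ 4) ^ m)) (sumQ k f) ⟩
      ι (+ 4) ℚ.* (ι ((+ 4) ^ m) ℚ.* sumQ k f)    ≡⟨ cong (ι (+ 4) ℚ.*_) (4^-sumQ h x m) ⟩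
      ι (+ 4) ℚ.* ι Lm                            ≡⟨ ι-*-ι (+ 4) Lm ⟨
      ι (+ 4 * Lm)                                ∎
    new : ι ((+ 4) ^ k) ℚ.* f k ≡ ι (v ^ k * bin x k * superCatalan k 0)
    new = begin
      ι ((+ 4) ^ k) ℚ.* f k
        ≡⟨ x∙yz≈y∙xz (ι ((+ 4) ^ k)) (binomQ x k ℚ.* (+ ((2 ℕ.* k) C k) / 1)) (powQ q k) ⟩
      binomQ x k ℚ.* (+ ((2 ℕ.* k) C k) / 1) ℚ.* (ι ((+ 4) ^ k) ℚ.* powQ q k)
        ≡⟨ cong₂ ℚ._*_ (cong₂ ℚ._*_ (binomQ-bin x k) (cong ι (sym (centralBin-C k)))) (4^-powQ h k) ⟩
      ι (bin x k) ℚ.* ι (superCatalan k 0) ℚ.* ι (v ^ k)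
        ≡⟨ cong (ℚ._* ι (v ^ k)) (ι-*-ι (bin x k) (superCatalan k 0)) ⟨
      ι (bin x k * superCatalan k 0) ℚ.* ι (v ^ k)
        ≡⟨ ι-*-ι (bin x k * superCatalan k 0) (v ^ k) ⟨
      ι (bin x k * superCatalan k 0 * v ^ k)
        ≡⟨ cong ι (lem (bin x k) (superCatalan k 0) (v ^ k)) ⟩
      ι (v ^ k * bin x k * superCatalan k 0) ∎
      where
      lem : ∀ b s v → b * s * v ≡ v * b * s
      lem = solve-∀

  -- Clearing denominators in a q = b gives a times the numerator of q equal to b times its
  -- denominator.
  numerator-∣ : ∀ {d a b} q → ι a ℚ.* q ≡ ι b → d ∣ b → d ∣ a * ℚ.↥ q
  numerator-∣ {d} {a} {b} q@record{} e d∣b = subst (d ∣_) (sym (clear cross)) (∣m⇒∣m*n (ℚ.↧ q) d∣b)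
    where
    cross : mkℚᵘ a 0 ℚᵘ.* toℚᵘ q ℚᵘ.≃ mkℚᵘ b 0
    cross = ℚᵘ.≃-trans (ℚᵘ.*-cong (ℚᵘ.≃-sym (ℚ.toℚᵘ-fromℚᵘ (mkℚᵘ a 0))) (ℚᵘ.≃-refl {toℚᵘ q}))
      (ℚᵘ.≃-trans (ℚᵘ.≃-sym (ℚ.toℚᵘ-homo-* (ι a) q))
      (ℚᵘ.≃-trans (ℚ.toℚᵘ-cong e) (ℚ.toℚᵘ-fromℚᵘ (mkℚᵘ b 0))))
    clear : mkℚᵘ a 0 ℚᵘ.* toℚᵘ q ℚᵘ.≃ mkℚᵘ b 0 → a * ℚ.↥ q ≡ b * ℚ.↧ q
    clear (*≡* r) = trans (sym (ℤ.*-identityʳ (a * ℚ.↥ q)))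
      (trans r (cong (λ z → b * + suc z) (ℕ.+-identityʳ (ℚ.denominator-1 q))))

  -- Removing the factor 4ᵐ, which is prime to p.

  module _ {p : ℕ} (pr : Prime p) (p∤2 : ¬ (p ℕ.∣ 2)) where

    4^-cancel : ∀ e m {y} → + (p ℕ.^ e) ∣ (+ 4) ^ m * y → + (p ℕ.^ e) ∣ y
    4^-cancel e zero    {y} d = subst (+ (p ℕ.^ e) ∣_) (ℤ.*-identityˡ y) d
    4^-cancel e (suc m) {y} d = 4^-cancel e m (halve pr p∤2 e (halve pr p∤2 e
      (subst (+ (p ℕ.^ e) ∣_) (lem ((+ 4) ^ m) y) d)))
      where
      lem : ∀ a y → + 4 * a * y ≡ + 2 * (+ 2 * (a * y))
      lem = solve-∀

    S-∣ : ∀ h m e → + (p ℕ.^ e) ∣ L (+ 4) superCatalan (1ℤ - + 2 * h) (h * + suc m - 1ℤ) m →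
      DivQ (p ℕ.^ e) (S h (suc m))
    S-∣ h m e d = ∣⇒∣ᵤ (4^-cancel e m (numerator-∣ {a = (+ 4) ^ m} (S h (suc m)) (4^-sumQ h (h * + suc m - 1ℤ) m) d))

open import Data.Nat using (_^_; _≥_; _>_; _+_)
open import Data.Nat.Divisibility using (_∣_)
open Integral

theorem1p1 : (p : ℕ) → Prime p → ¬ (2 ∣ p) →
    (h : ℤ) → (+ p) ℤDiv.∣ (+ 2 ℤ.* h ℤ.- + 1) →
    ((a : ℕ) → a ≥ 1 → p ^ a > 3 → DivQ (p ^ (a + 1)) (S h (p ^ a)))
    × ((n : ℕ) → n ≥ 1 → (e : ℕ) → p ^ e ∣ n → DivQ (p ^ e) (S h n))
theorem1p1 p pr 2∤p h p∣2h-1 = part₁ , part₂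
  where
  p∤2 : ¬ (p ∣ 2)
  p∤2 = ℕ.>⇒∤ (odd-prime≥3 pr 2∤p)
  part₁ : ∀ a → a ≥ 1 → p ^ a > 3 → DivQ (p ^ (a + 1)) (S h (p ^ a))
  part₁ a _ n>3 with p ^ a in eq
  ... | suc m = subst (λ k → DivQ (p ^ k) (S h (suc m))) (ℕ.+-comm 1 a)
    (S-∣ pr p∤2 h m (suc a) (L-∣-power pr 2∤p h (∣ᵤ⇒∣ p∣2h-1) m a (sym eq) n>3))
  part₂ : ∀ n → n ≥ 1 → ∀ e → p ^ e ∣ n → DivQ (p ^ e) (S h n)
  part₂ (suc m) _ e d = S-∣ pr p∤2 h m e (L-∣-general pr 2∤p h (∣ᵤ⇒∣ p∣2h-1) m e d)
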